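{- Let $R \subseteq \mathcal{F}$ be a unary cardinality relation that is not definable in $(\mathbb{N},<)$. The functions $+$ and $\times$ on $\mathbb{N}$ are definable in $(\mathbb{N},<,R)$. Thus $\mathrm{WMSO}(\mathbb{N},<,R)$ is undecidable.
   Context: $\mathcal{F}$ denotes the set of finite subsets of $\mathbb{N}$ and $|X|$ the cardinality of $X\in\mathcal{F}$. Definable means definable in weak monadic second-order logic (WMSO): first-order variables range over $\mathbb{N}$, monadic second-order variables range over finite subsets of $\mathbb{N}$, and atomic formulas use membership $x\in X$ and the symbols of the signature (the symbol $R$ takes one monadic second-order argument). A relation $S\subseteq\mathbb{N}^m\times\mathcal{F}^k$ is definable in a structure with domain $\mathbb{N}$ if there is a WMSO formula $\varphi(x_1,\dots,x_m,X_1,\dots,X_k)$ over its signature that holds exactly for the tuples of $S$. A function on $\mathbb{N}$ is definable if its graph is. $\mathrm{WMSO}(\mathcal{M})$ denotes the weak monadic second-order theory of $\mathcal{M}$, i.e. the set of WMSO sentences true in $\mathcal{M}$. A unary cardinality relation is a set $R\subseteq\mathcal{F}$ such that for all $X,Y\in\mathcal{F}$ with $|X|=|Y|$, we have $X\in R$ iff $Y\in R$. -}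

module Defs where

open import Data.Fin.Base using (Fin; zero; suc; toℕ)
open import Data.List.Base using (List; []; _∷_; length)
import Data.List.Base as List
open import Data.List.Membership.Propositional using () renaming (_∈_ to _∈ˡ_)
open import Data.List.Relation.Unary.AllPairs using (AllPairs)
open import Data.Nat.Base using (ℕ; zero; suc; _+_; _*_; _<_)
open import Data.Product.Base using (Σ; ∃; _×_; _,_; proj₁; proj₂)
open import Data.Sum.Base using (_⊎_)
open import Data.Vec.Base using (Vec; []; _∷_; lookup; map)
open import Function.Bundles using (_⇔_)
open import Level using (0ℓ)
open import Relation.Binary.PropositionalEquality using (_≡_)
open import Relation.Nullary using (¬_)
open import Relation.Unary using (Pred)

private variable
  m k n l : ℕ

-- A finite subset of ℕ is represented by the strictly increasing list of its
-- elements, so that extensionally equal sets are propositionally equal.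
record 𝓕 : Set where
  constructor mk𝓕
  field
    elements   : List ℕ
    increasing : AllPairs _<_ elements

open 𝓕 public

infix 4 _∈_

_∈_ : ℕ → 𝓕 → Set
x ∈ X = x ∈ˡ elements X

∣_∣ : 𝓕 → ℕ
∣ X ∣ = length (elements X)

IsCardinalityRelation : Pred 𝓕 0ℓ → Set
IsCardinalityRelation R = ∀ X Y → ∣ X ∣ ≡ ∣ Y ∣ → R X ⇔ R Y

Relation : ℕ → ℕ → Set₁
Relation m k = Vec ℕ m → Vec 𝓕 k → Set

-- A finite relational signature lists, for each of its symbols, the number of
-- first-order and the number of monadic second-order arguments.
Signature : Set
Signature = List (ℕ × ℕ)

Symbol : Signature → Set
Symbol σ = Fin (length σ)

arity₁ arity₂ : (σ : Signature) → Symbol σ → ℕ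
arity₁ σ s = proj₁ (List.lookup σ s)
arity₂ σ s = proj₂ (List.lookup σ s)

record Structure (σ : Signature) : Set₁ where
  field
    interpret : (s : Symbol σ) → Relation (arity₁ σ s) (arity₂ σ s)

open Structure public

-- Formulas with m free first-order and k free second-order variables.  The two
-- sorts have separate de Bruijn indices; a quantifier binds index zero of its
-- sort.  There is no primitive equality.
data Formula (σ : Signature) (m k : ℕ) : Set where
  mem  : Fin m → Fin k → Formula σ m k
  rel  : (s : Symbol σ) → Vec (Fin m) (arity₁ σ s) → Vec (Fin k) (arity₂ σ s) →
         Formula σ m k
  neg  : Formula σ m k → Formula σ m k
  and  : Formula σ m k → Formula σ m k → Formula σ m k
  or   : Formula σ m k → Formula σ m k → Formula σ m k
  imp  : Formula σ m k → Formula σ m k → Formula σ m k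
  all₁ : Formula σ (suc m) k → Formula σ m k
  ex₁  : Formula σ (suc m) k → Formula σ m k
  all₂ : Formula σ m (suc k) → Formula σ m k
  ex₂  : Formula σ m (suc k) → Formula σ m k

Sentence : Signature → Set
Sentence σ = Formula σ 0 0

module _ {σ : Signature} (𝓜 : Structure σ) where

  Sat : Formula σ m k → Relation m k
  Sat (mem x X)     xs Xs = lookup xs x ∈ lookup Xs X
  Sat (rel s is Is) xs Xs = interpret 𝓜 s (map (lookup xs) is) (map (lookup Xs) Is)
  Sat (neg φ)       xs Xs = ¬ Sat φ xs Xs
  Sat (and φ ψ)     xs Xs = Sat φ xs Xs × Sat ψ xs Xs
  Sat (or φ ψ)      xs Xs = Sat φ xs Xs ⊎ Sat ψ xs Xs
  Sat (imp φ ψ)     xs Xs = Sat φ xs Xs → Sat ψ xs Xs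
  Sat (all₁ φ)      xs Xs = (x : ℕ) → Sat φ (x ∷ xs) Xs
  Sat (ex₁ φ)       xs Xs = Σ ℕ λ x → Sat φ (x ∷ xs) Xs
  Sat (all₂ φ)      xs Xs = (X : 𝓕) → Sat φ xs (X ∷ Xs)
  Sat (ex₂ φ)       xs Xs = Σ 𝓕 λ X → Sat φ xs (X ∷ Xs)

  Definable : Relation m k → Set
  Definable {m} {k} S =
    Σ (Formula σ m k) λ φ → ∀ xs Xs → Sat φ xs Xs ⇔ S xs Xs

  WMSO : Pred (Sentence σ) 0ℓ
  WMSO φ = Sat φ [] []

graph : (ℕ → ℕ → ℕ) → Relation 3 0
graph f (x ∷ y ∷ z ∷ []) [] = f x y ≡ z

DefinableFunction : {σ : Signature} → Structure σ → (ℕ → ℕ → ℕ) → Set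
DefinableFunction 𝓜 f = Definable 𝓜 (graph f)

unary : Pred 𝓕 0ℓ → Relation 0 1
unary R [] (X ∷ []) = R X

⟨ℕ,<⟩ : Structure ((2 , 0) ∷ [])
interpret ⟨ℕ,<⟩ zero (x ∷ y ∷ []) [] = x < y

⟨ℕ,<,_⟩ : Pred 𝓕 0ℓ → Structure ((2 , 0) ∷ (0 , 1) ∷ [])
interpret ⟨ℕ,<, R ⟩ zero       (x ∷ y ∷ []) [] = x < y
interpret ⟨ℕ,<, R ⟩ (suc zero) = unary R

-- Partial recursive functions.  `prec` recurses on its first argument; `μ`
-- searches for the least value of the first argument of its body.
data Rec : ℕ → Set where
  zer  : Rec n
  succ : Rec 1
  proj : Fin n → Rec n
  comp : Rec l → Vec (Rec n) l → Rec n
  prec : Rec n → Rec (suc (suc n)) → Rec (suc n)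
  μ    : Rec (suc n) → Rec n

infix 4 _[_]⇓_

-- f [ xs ]⇓ y : the value of f at xs is defined and equals y.
data _[_]⇓_ : Rec n → Vec ℕ n → ℕ → Set where
  zer⇓  : {xs : Vec ℕ n} → zer [ xs ]⇓ 0
  succ⇓ : ∀ {x} → succ [ x ∷ [] ]⇓ suc x
  proj⇓ : {xs : Vec ℕ n} (i : Fin n) → proj i [ xs ]⇓ lookup xs i
  comp⇓ : ∀ {f : Rec l} {gs : Vec (Rec n) l} {xs y} (ys : Vec ℕ l) →
          (∀ i → lookup gs i [ xs ]⇓ lookup ys i) → f [ ys ]⇓ y →
          comp f gs [ xs ]⇓ y
  prec₀ : ∀ {f : Rec n} {g xs y} → f [ xs ]⇓ y → prec f g [ 0 ∷ xs ]⇓ y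
  precₛ : ∀ {f : Rec n} {g xs i r y} →
          prec f g [ i ∷ xs ]⇓ r → g [ i ∷ r ∷ xs ]⇓ y →
          prec f g [ suc i ∷ xs ]⇓ y
  μ⇓    : ∀ {f : Rec (suc n)} {xs y} →
          f [ y ∷ xs ]⇓ 0 →
          (∀ z → z < y → ∃ λ v → f [ z ∷ xs ]⇓ suc v) →
          μ f [ xs ]⇓ y

-- An injective pairing: with s = x + y, the value lies between s² and s² + s.
pair : ℕ → ℕ → ℕ
pair x y = (x + y) * (x + y) + x

⌜_⌝ᵛ : Vec (Fin n) l → ℕ
⌜ [] ⌝ᵛ     = 0
⌜ i ∷ is ⌝ᵛ = pair (toℕ i) ⌜ is ⌝ᵛ

-- Gödel numbering, injective on Formula σ m k for fixed σ, m and k.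
⌜_⌝ : {σ : Signature} → Formula σ m k → ℕ
⌜ mem x X ⌝     = pair 0 (pair (toℕ x) (toℕ X))
⌜ rel s is Is ⌝ = pair 1 (pair (toℕ s) (pair ⌜ is ⌝ᵛ ⌜ Is ⌝ᵛ))
⌜ neg φ ⌝       = pair 2 ⌜ φ ⌝
⌜ and φ ψ ⌝     = pair 3 (pair ⌜ φ ⌝ ⌜ ψ ⌝)
⌜ or φ ψ ⌝      = pair 4 (pair ⌜ φ ⌝ ⌜ ψ ⌝)
⌜ imp φ ψ ⌝     = pair 5 (pair ⌜ φ ⌝ ⌜ ψ ⌝)
⌜ all₁ φ ⌝      = pair 6 ⌜ φ ⌝
⌜ ex₁ φ ⌝       = pair 7 ⌜ φ ⌝
⌜ all₂ φ ⌝      = pair 8 ⌜ φ ⌝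
⌜ ex₂ φ ⌝       = pair 9 ⌜ φ ⌝

-- Decidability is recursiveness, not the existence of a function into `Dec`:
-- the latter exists for every T under excluded middle.
RecursivelyDecidable : {σ : Signature} → Pred (Sentence σ) 0ℓ → Set
RecursivelyDecidable {σ} T = Σ (Rec 1) λ f → (φ : Sentence σ) →
  (T φ → f [ ⌜ φ ⌝ ∷ [] ]⇓ 1) × (¬ T φ → f [ ⌜ φ ⌝ ∷ [] ]⇓ 0)

Undecidable : {σ : Signature} → Pred (Sentence σ) 0ℓ → Set
Undecidable T = ¬ RecursivelyDecidable T

{-# OPTIONS --safe #-}
module Submission where

-- A set of sizes is definable in (ℕ, <) as soon as it is ultimately periodic.
-- Since R is not definable, adding one and the same set Z to X and to Y, disjoint
-- from both, tells |X| and |Y| apart for some Z unless |X| = |Y|: otherwise the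
-- sizes of R would be ultimately periodic.  So equicardinality is definable from
-- R.  Disjoint unions then give +, and cutting a set into consecutive blocks of
-- equal size gives ×.  Graphs of recursive functions become definable, with a
-- finite set of codes of pairs as a certificate for a primitive recursion, and a
-- decision procedure for the theory could be applied to a sentence stating its
-- own rejection.
--
-- Membership in R need not be decidable, so the finitely many values of R that a
-- periodic definition depends on are only decided under a double negation, which
-- suffices because equality of sizes is stable.

open import Data.Fin.Base using (Fin; zero; suc; _↑ˡ_; _↑ʳ_)
open import Data.Fin.Patterns using (0F; 1F; 2F; 3F; 4F)
open import Data.List.Base using (List; []; _∷_; _++_; length; filter; upTo; applyUpTo)
open import Data.List.Extrema.Nat using (max; xs≤max)
open import Data.List.Membership.Propositional using (find; lose) renaming (_∈_ to _∈ˡ_)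
open import Data.List.Membership.Propositional.Properties
  using (∈-filter⁺; ∈-filter⁻; ∈-upTo⁺; ∈-applyUpTo⁺; ∈-applyUpTo⁻; ∈-++⁺ˡ; ∈-++⁺ʳ; ∈-++⁻)
open import Data.List.Membership.Propositional.Properties.WithK using (unique∧set⇒bag)
open import Data.List.Properties using (length-++; length-applyUpTo)
open import Data.List.Relation.Binary.BagAndSetEquality using (∼bag⇒↭)
open import Data.List.Relation.Binary.Permutation.Propositional.Properties using (↭-length)
open import Data.List.Relation.Unary.All as All using ([]; _∷_)
open import Data.List.Relation.Unary.AllPairs as AllPairs using (AllPairs; []; _∷_)
import Data.List.Relation.Unary.AllPairs.Properties as AllPairs
open import Data.List.Relation.Unary.Any using (here; there; any?)
open import Data.List.Relation.Unary.Unique.Propositional using (Unique)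
import Data.List.Relation.Unary.Unique.Propositional.Properties as Unique
open import Data.Nat.Base
open import Data.Nat.DivMod using (_/_; _%_; m≡m%n+[m/n]*n; m%n<n)
open import Data.Nat.Properties
open import Data.List.Membership.DecPropositional _≟_ using (_∈?_)
open import Data.Product.Base using (Σ; ∃; ∃₂; _×_; _,_; proj₁; proj₂)
open import Data.Sum.Base as Sum using (_⊎_; inj₁; inj₂; [_,_]′)
open import Data.Vec.Base as Vec using (Vec; []; _∷_; lookup; tabulate)
import Data.Vec.Functional as Fun
open import Data.Vec.Properties using (lookup-++ˡ; lookup-++ʳ; lookup∘tabulate; tabulate∘lookup; tabulate-cong)
open import Function.Base using (_∘_; id)
open import Function.Bundles using (_⇔_; mk⇔; Equivalence)
open import Function.Construct.Composition using (_⇔-∘_)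
open import Function.Construct.Identity using (⇔-id)
open import Function.Construct.Symmetry using (⇔-sym)
open import Level using (0ℓ)
open import Relation.Binary.Definitions using (tri<; tri≈; tri>)
open import Relation.Binary.PropositionalEquality
open import Relation.Nullary using (¬_; Dec; yes; no; contradiction)
open import Relation.Nullary.Decidable using (¬?; ¬¬-excluded-middle)
open import Relation.Unary using (Pred)
open import Defs

open Equivalence using (to; from)

private variable
  m k n l : ℕ

-- Finite sets and their sizes

elements-unique : (X : 𝓕) → Unique (elements X)
elements-unique X = AllPairs.map <⇒≢ (increasing X)

-- Increasing lists have no repetitions, so equal membership already makes the two lists
-- permutations of each other.
∣∣-cong : ∀ X Y → (∀ u → u ∈ X ⇔ u ∈ Y) → ∣ X ∣ ≡ ∣ Y ∣
∣∣-cong X Y X≐Y =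
  ↭-length (∼bag⇒↭ (unique∧set⇒bag (elements-unique X) (elements-unique Y) (X≐Y _)))

IsDisjointUnion : 𝓕 → 𝓕 → 𝓕 → Set
IsDisjointUnion X Y Z =
  ∀ u → (u ∈ Z → u ∈ X ⊎ u ∈ Y) × (u ∈ X → u ∈ Z) × (u ∈ Y → u ∈ Z) × ¬ (u ∈ X × u ∈ Y)

-- By disjointness the concatenated list is free of repetitions, hence a permutation of
-- `elements Z`, although it need not be increasing.
∣∣-disjointUnion : ∀ X Y Z → IsDisjointUnion X Y Z → ∣ Z ∣ ≡ ∣ X ∣ + ∣ Y ∣
∣∣-disjointUnion X Y Z Z≐X⊎Y = trans
  (↭-length (∼bag⇒↭ (unique∧set⇒bag (elements-unique Z)
    (Unique.++⁺ (elements-unique X) (elements-unique Y) λ {u} → proj₂ (proj₂ (proj₂ (Z≐X⊎Y u))))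
    λ {u} → mk⇔ ([ ∈-++⁺ˡ , ∈-++⁺ʳ _ ]′ ∘ proj₁ (Z≐X⊎Y u))
                ([ proj₁ (proj₂ (Z≐X⊎Y u)) , proj₁ (proj₂ (proj₂ (Z≐X⊎Y u))) ]′ ∘ ∈-++⁻ _))))
  (length-++ (elements X))

-- Filtering an initial segment of ℕ sorts the list and removes its repetitions at once.
fromList : List ℕ → 𝓕
fromList xs = mk𝓕 (filter (_∈? xs) (upTo (suc (max 0 xs))))
  (AllPairs.filter⁺ (_∈? xs) (AllPairs.applyUpTo⁺₁ id _ λ i<j _ → i<j))

∈-fromList : ∀ xs {u} → u ∈ fromList xs ⇔ u ∈ˡ xs
∈-fromList xs = mk⇔ (proj₂ ∘ ∈-filter⁻ (_∈? xs) {xs = upTo (suc (max 0 xs))})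
  λ u∈xs → ∈-filter⁺ (_∈? xs) (∈-upTo⁺ (s≤s (All.lookup (xs≤max 0 xs) u∈xs))) u∈xs

∅ : 𝓕
∅ = mk𝓕 [] []

∣∣≡0⇒∉ : ∀ X → ∣ X ∣ ≡ 0 → ∀ {u} → ¬ u ∈ X
∣∣≡0⇒∉ (mk𝓕 [] _) refl ()

∉⇒∣∣≡0 : ∀ X → (∀ u → ¬ u ∈ X) → ∣ X ∣ ≡ 0
∉⇒∣∣≡0 (mk𝓕 []      _) ∉ = refl
∉⇒∣∣≡0 (mk𝓕 (x ∷ _) _) ∉ = contradiction (here refl) (∉ x)

singleton : ℕ → 𝓕
singleton x = mk𝓕 (x ∷ []) ([] ∷ [])

interval : ℕ → ℕ → 𝓕
interval a n = mk𝓕 (applyUpTo (a +_) n) (AllPairs.applyUpTo⁺₁ (a +_) n λ i<j _ → +-monoʳ-< a i<j)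

∣interval∣ : ∀ a n → ∣ interval a n ∣ ≡ n
∣interval∣ a n = length-applyUpTo (a +_) n

∈-interval : ∀ a n {u} → u ∈ interval a n ⇔ (a ≤ u × u < a + n)
∈-interval a n = mk⇔ fwd bwd
  where
  fwd : ∀ {u} → u ∈ interval a n → a ≤ u × u < a + n
  fwd u∈ with ∈-applyUpTo⁻ (a +_) u∈
  ... | i , i<n , refl = m≤m+n a i , +-monoʳ-< a i<n
  bwd : ∀ {u} → a ≤ u × u < a + n → u ∈ interval a n
  bwd {u} (a≤u , u<a+n) = subst (_∈ interval a n) (m+[n∸m]≡n a≤u)
    (∈-applyUpTo⁺ (a +_) (+-cancelˡ-< a _ _ (subst (_< a + n) (sym (m+[n∸m]≡n a≤u)) u<a+n)))

-- The Z asked for in the definition of equicardinality: a large enough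
-- interval above X and Y.
disjointUnion-interval : ∀ X N n → (∀ {u} → u ∈ X → u < N) →
  Σ 𝓕 (IsDisjointUnion X (interval N n))
disjointUnion-interval X N n X<N = fromList (elements X ++ elements (interval N n)) , λ u →
  (λ u∈ → ∈-++⁻ (elements X) (to (∈-fromList _) u∈)) ,
  (λ u∈X → from (∈-fromList _) (∈-++⁺ˡ u∈X)) ,
  (λ u∈I → from (∈-fromList (elements X ++ _)) (∈-++⁺ʳ _ u∈I)) ,
  λ (u∈X , u∈I) → <⇒≱ (X<N u∈X) (proj₁ (to (∈-interval N n) u∈I))

-- Induction on `a`, moving the least element into `L` each time. The order between `L` and `U` is
-- what lets `L` serve as a first block.
splitAt : ∀ X a {b} → ∣ X ∣ ≡ a + b →
  ∃₂ λ L U → ∣ L ∣ ≡ a × ∣ U ∣ ≡ b × IsDisjointUnion L U X × (∀ {u v} → u ∈ L → v ∈ U → u < v)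
splitAt X zero ∣X∣ = ∅ , X , refl , ∣X∣ , (λ u → inj₂ , (λ ()) , id , λ ()) , λ ()
splitAt (mk𝓕 (x ∷ xs) (x<xs ∷ xs↗)) (suc a) ∣X∣ with splitAt (mk𝓕 xs xs↗) a (suc-injective ∣X∣)
... | L , U , ∣L∣ , ∣U∣ , L⊎U , L<U =
  mk𝓕 (x ∷ elements L) (All.tabulate (x<_ ∘ proj₁ (proj₂ (L⊎U _))) ∷ increasing L) , U ,
  cong suc ∣L∣ , ∣U∣ ,
  (λ u →
    (λ { (here refl) → inj₁ (here refl) ; (there u∈xs) → Sum.map₁ there (proj₁ (L⊎U u) u∈xs) }) ,
    (λ { (here refl) → here refl ; (there u∈L) → there (proj₁ (proj₂ (L⊎U u)) u∈L) }) ,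
    (λ u∈U → there (U⊆xs u∈U)) ,
    λ { (here refl , u∈U) → <-irrefl refl (x<_ (U⊆xs u∈U))
      ; (there u∈L , u∈U) → proj₂ (proj₂ (proj₂ (L⊎U u))) (u∈L , u∈U) }) ,
  λ { (here refl) v∈U → x<_ (U⊆xs v∈U) ; (there u∈L) v∈U → L<U u∈L v∈U }
  where
  x<_ : ∀ {u} → u ∈ˡ xs → x < u
  x<_ = All.lookup x<xs
  U⊆xs : ∀ {u} → u ∈ U → u ∈ˡ xs
  U⊆xs = proj₁ (proj₂ (proj₂ (L⊎U _)))

-- Cutting a set into blocks of equal size

IsBlock : 𝓕 → 𝓕 → ℕ → 𝓕 → Set
IsBlock W Y y B =
  ∀ u → (u ∈ B → u ∈ W × y ≤ u × (∀ v → v ∈ Y → y < v → u < v)) ×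
        (u ∈ W → y ≤ u → (∀ v → v ∈ Y → y < v → u < v) → u ∈ B)

-- The elements of Y start consecutive blocks of c elements each, covering W.
IsBlocking : ℕ → 𝓕 → 𝓕 → Set
IsBlocking c W Y = (∀ x → x ∈ W → ∃ λ y → y ∈ Y × y ≤ x) ×
                   (∀ y → y ∈ Y → ∃ λ B → IsBlock W Y y B × ∣ B ∣ ≡ c)

-- Induction on the starts: removing the block `B` of the least start leaves a set that is blocked
-- by the remaining starts, and the two sizes add.
∣∣-blocking : ∀ {c} W {ys} (ys↗ : AllPairs _<_ ys) →
  IsBlocking c W (mk𝓕 ys ys↗) → ∣ W ∣ ≡ c * length ys
∣∣-blocking {c} W [] (cover , _) = trans
  (∉⇒∣∣≡0 W λ u u∈W → contradiction (proj₁ (proj₂ (cover u u∈W))) λ ()) (sym (*-zeroʳ c))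
∣∣-blocking {c} W {y ∷ ys} (y<ys ∷ ys↗) (cover , blocks) with blocks y (here refl)
... | B , isB , ∣B∣ = begin
  ∣ W ∣              ≡⟨ ∣∣-disjointUnion B W′ W W≐B⊎W′ ⟩
  ∣ B ∣ + ∣ W′ ∣     ≡⟨ cong₂ _+_ ∣B∣ (∣∣-blocking W′ ys↗ (cover′ , blocks′)) ⟩
  c + c * length ys  ≡⟨ *-suc c _ ⟨
  c * suc (length ys) ∎
  where
  open ≡-Reasoning
  Y′ : 𝓕
  Y′ = mk𝓕 ys ys↗
  ∉B? : ∀ u → Dec (¬ u ∈ B)
  ∉B? u = ¬? (u ∈? elements B)
  W′ : 𝓕
  W′ = mk𝓕 (filter ∉B? (elements W)) (AllPairs.filter⁺ ∉B? (increasing W))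
  W′⇒ : ∀ {u} → u ∈ W′ → u ∈ W × ¬ u ∈ B
  W′⇒ = ∈-filter⁻ ∉B? {xs = elements W}
  W≐B⊎W′ : IsDisjointUnion B W′ W
  W≐B⊎W′ u = W⇒ , (λ u∈B → proj₁ (proj₁ (isB u) u∈B)) , (λ u∈W′ → proj₁ (W′⇒ u∈W′)) ,
    λ (u∈B , u∈W′) → proj₂ (W′⇒ u∈W′) u∈B
    where
    W⇒ : u ∈ W → u ∈ B ⊎ u ∈ W′
    W⇒ u∈W with u ∈? elements B
    ... | yes u∈B = inj₁ u∈B
    ... | no  u∉B = inj₂ (∈-filter⁺ ∉B? u∈W u∉B)
  cover′ : ∀ x → x ∈ W′ → ∃ λ y′ → y′ ∈ Y′ × y′ ≤ x
  cover′ x x∈W′ with cover x (proj₁ (W′⇒ x∈W′))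
  ... | y′ , there y′∈ys , y′≤x = y′ , y′∈ys , y′≤x
  ... | _  , here refl   , y≤x with any? (_≤? x) ys
  ...   | yes p  = let v , v∈ys , v≤x = find p in v , v∈ys , v≤x
  -- With no later start at or below `x`, the element `x` would lie in the block of `y`, which `W′`
  -- excludes.
  ...   | no  ¬p = contradiction
    (proj₂ (isB x) (proj₁ (W′⇒ x∈W′)) y≤x
      λ { v (here refl) y<y → contradiction y<y (<-irrefl refl)
        ; v (there v∈ys) _ → ≰⇒> λ v≤x → ¬p (lose v∈ys v≤x) })
    (proj₂ (W′⇒ x∈W′))
  blocks′ : ∀ y′ → y′ ∈ Y′ → ∃ λ B′ → IsBlock W′ Y′ y′ B′ × ∣ B′ ∣ ≡ c
  blocks′ y′ y′∈ys with blocks y′ (there y′∈ys)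
  ... | B′ , isB′ , ∣B′∣ = B′ , isBlock , ∣B′∣
    where
    isBlock : IsBlock W′ Y′ y′ B′
    isBlock u =
      (λ u∈B′ → let u∈W , y′≤u , u<Y = proj₁ (isB′ u) u∈B′ in
        -- Elements of `B` lie below every later start, in particular below `y′`.
        ∈-filter⁺ ∉B? u∈W (λ u∈B →
          <⇒≱ (proj₂ (proj₂ (proj₁ (isB u) u∈B)) y′ (there y′∈ys) (All.lookup y<ys y′∈ys)) y′≤u) ,
        y′≤u , λ v v∈ys → u<Y v (there v∈ys)) ,
      λ u∈W′ y′≤u u<ys → proj₂ (isB′ u) (proj₁ (W′⇒ u∈W′)) y′≤u
        λ { v (here refl) y′<y → contradiction (All.lookup y<ys y′∈ys) (<⇒≯ y′<y)
          ; v (there v∈ys) y′<v → u<ys v v∈ys y′<v }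

blocking : ∀ c q W → ∣ W ∣ ≡ c * q → ∃ λ Y → IsBlocking c W Y × ∣ Y ∣ ≡ q
-- For `c = 0` the set `W` and all blocks are empty, so any `Y` with `q` elements serves; starts
-- need not belong to `W`.
blocking zero q W ∣W∣ = interval 0 q ,
  ((λ x x∈W → contradiction x∈W (∣∣≡0⇒∉ W ∣W∣)) ,
   λ y _ → ∅ , (λ u → (λ ()) , λ u∈W → contradiction u∈W (∣∣≡0⇒∉ W ∣W∣)) , refl) ,
  ∣interval∣ 0 q
blocking (suc c) q W ∣W∣ = let Y , Y⊆W , Y-blocks , ∣Y∣ = go q W ∣W∣ in Y , Y-blocks , ∣Y∣
  where
  -- Having `Y` inside `W` strengthens the induction: the starts found for `U` then lie above all of
  -- `L`, whose least element `w` becomes the first start.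
  go : ∀ q W → ∣ W ∣ ≡ suc c * q →
    ∃ λ Y → (∀ {u} → u ∈ Y → u ∈ W) × IsBlocking (suc c) W Y × ∣ Y ∣ ≡ q
  go zero W ∣W∣ = ∅ , (λ ()) ,
    ((λ x x∈W → contradiction x∈W (∣∣≡0⇒∉ W (trans ∣W∣ (*-zeroʳ (suc c))))) , λ y ()) , refl
  go (suc q) W ∣W∣ with splitAt W (suc c) (trans ∣W∣ (*-suc (suc c) q))
  ... | mk𝓕 (w ∷ l) (w<l ∷ l↗) , U , ∣L∣ , ∣U∣ , W≐L⊎U , L<U with go q U ∣U∣
  ...   | Y , Y⊆U , (cover , blocks) , ∣Y∣ = Y⁺ , Y⁺⊆W , (cover⁺ , blocks⁺) , cong suc ∣Y∣
    where
    L Y⁺ : 𝓕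
    L = mk𝓕 (w ∷ l) (w<l ∷ l↗)
    Y⁺ = mk𝓕 (w ∷ elements Y) (All.tabulate (λ u∈Y → L<U (here refl) (Y⊆U u∈Y)) ∷ increasing Y)
    L⊆W : ∀ {u} → u ∈ L → u ∈ W
    L⊆W = proj₁ (proj₂ (W≐L⊎U _))
    U⊆W : ∀ {u} → u ∈ U → u ∈ W
    U⊆W = proj₁ (proj₂ (proj₂ (W≐L⊎U _)))
    w≤L : ∀ {u} → u ∈ L → w ≤ u
    w≤L (here refl) = ≤-refl
    w≤L (there u∈l) = <⇒≤ (All.lookup w<l u∈l)
    Y⁺⊆W : ∀ {u} → u ∈ Y⁺ → u ∈ W
    Y⁺⊆W (here refl) = L⊆W (here refl)
    Y⁺⊆W (there u∈Y) = U⊆W (Y⊆U u∈Y)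
    cover⁺ : ∀ x → x ∈ W → ∃ λ y → y ∈ Y⁺ × y ≤ x
    cover⁺ x x∈W with proj₁ (W≐L⊎U x) x∈W
    ... | inj₁ x∈L = w , here refl , w≤L x∈L
    ... | inj₂ x∈U = let y , y∈Y , y≤x = cover x x∈U in y , there y∈Y , y≤x
    blocks⁺ : ∀ y → y ∈ Y⁺ → ∃ λ B → IsBlock W Y⁺ y B × ∣ B ∣ ≡ suc c
    blocks⁺ y (here refl) = L , isBlock , ∣L∣
      where
      isBlock : IsBlock W Y⁺ w L
      isBlock u = (λ u∈L → L⊆W u∈L , w≤L u∈L ,
          λ { v (here refl) w<w → contradiction w<w (<-irrefl refl)
            ; v (there v∈Y) _ → L<U u∈L (Y⊆U v∈Y) }) ,
        -- An element of `U` has a start at or below it, so it cannot lie below all starts after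
        -- `w`.
        λ u∈W _ u<Y → [ id , (λ u∈U → let v , v∈Y , v≤u = cover u u∈U in
          contradiction v≤u (<⇒≱ (u<Y v (there v∈Y) (L<U (here refl) (Y⊆U v∈Y))))) ]′
          (proj₁ (W≐L⊎U u) u∈W)
    blocks⁺ y (there y∈Y) with blocks y y∈Y
    ... | B , isB , ∣B∣ = B , isBlock , ∣B∣
      where
      isBlock : IsBlock W Y⁺ y B
      isBlock u =
        (λ u∈B → let u∈U , y≤u , u<Y = proj₁ (isB u) u∈B in U⊆W u∈U , y≤u ,
          λ { v (here refl) y<w → contradiction (L<U (here refl) (Y⊆U y∈Y)) (<⇒≯ y<w)
            ; v (there v∈Y) → u<Y v v∈Y }) ,
        λ u∈W y≤u u<Y → [ (λ u∈L → contradiction y≤u (<⇒≱ (L<U u∈L (Y⊆U y∈Y)))) ,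
            (λ u∈U → proj₂ (isB u) u∈U y≤u λ v v∈Y → u<Y v (there v∈Y)) ]′
          (proj₁ (W≐L⊎U u) u∈W)

-- Definability of + and ×

-- The structure is a parameter because these formulas serve both over `(ℕ, <)`, to define periodic
-- relations, and over `(ℕ, <, R)`.
module OrderFormulas {τ : Signature} (𝓜 : Structure ((2 , 0) ∷ τ))
  (<⇔ : ∀ {x y} → interpret 𝓜 zero (x ∷ y ∷ []) [] ⇔ x < y) where

  Fml : ℕ → ℕ → Set
  Fml = Formula ((2 , 0) ∷ τ)

  lt le eq : Fin m → Fin m → Fml m k
  lt x y = rel zero (x ∷ y ∷ []) []
  le x y = neg (lt y x)
  eq x y = and (le x y) (le y x)

  ≤⇔ : ∀ {x y} → (¬ interpret 𝓜 zero (y ∷ x ∷ []) []) ⇔ x ≤ y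
  ≤⇔ = mk⇔ (λ y≮x → ≮⇒≥ (y≮x ∘ from <⇔)) (λ x≤y → ≤⇒≯ x≤y ∘ to <⇔)

  ≡⇔ : ∀ {x y} → (¬ interpret 𝓜 zero (y ∷ x ∷ []) [] × ¬ interpret 𝓜 zero (x ∷ y ∷ []) []) ⇔ x ≡ y
  ≡⇔ = mk⇔ (λ (x≤y , y≤x) → ≤-antisym (to ≤⇔ x≤y) (to ≤⇔ y≤x))
           (λ x≡y → from ≤⇔ (≤-reflexive x≡y) , from ≤⇔ (≤-reflexive (sym x≡y)))

  disjointUnion : Fin k → Fin k → Fin k → Fml m k
  disjointUnion X Y Z = all₁
    (and (imp (mem 0F Z) (or (mem 0F X) (mem 0F Y)))
    (and (imp (mem 0F X) (mem 0F Z))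
    (and (imp (mem 0F Y) (mem 0F Z))
         (neg (and (mem 0F X) (mem 0F Y))))))

  isSingleton : Fin k → Fml m k
  isSingleton X = ex₁ (and (mem 0F X) (all₁ (imp (mem 0F X) (eq 0F 1F))))

  isSingleton⇔ : ∀ (X : Fin k) {xs : Vec ℕ m} {Xs} →
    Sat 𝓜 (isSingleton X) xs Xs ⇔ ∣ lookup Xs X ∣ ≡ 1
  isSingleton⇔ X {_} {Xs} = mk⇔
    (λ (x , x∈X , X⊆x) → ∣∣-cong (lookup Xs X) (singleton x) λ u →
      mk⇔ (λ u∈X → here (to ≡⇔ (X⊆x u u∈X))) λ { (here refl) → x∈X })
    (bwd (lookup Xs X))
    where
    bwd : ∀ X → ∣ X ∣ ≡ 1 → ∃ λ x → x ∈ X × (∀ u → u ∈ X → _)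
    bwd (mk𝓕 (x ∷ []) _) _ = x , here refl , λ { u (here u≡x) → from ≡⇔ u≡x }

  hasSize : ℕ → Fin k → Fml m k
  hasSize zero    X = all₁ (neg (mem 0F X))
  hasSize (suc n) X = ex₂ (ex₂ (and (isSingleton 1F)
    (and (hasSize n 0F) (disjointUnion 1F 0F (suc (suc X))))))

  hasSize⇔ : ∀ n (X : Fin k) {xs : Vec ℕ m} {Xs} →
    Sat 𝓜 (hasSize n X) xs Xs ⇔ ∣ lookup Xs X ∣ ≡ n
  hasSize⇔ zero X {_} {Xs} =
    mk⇔ (∉⇒∣∣≡0 (lookup Xs X)) (λ ∣X∣ u → ∣∣≡0⇒∉ (lookup Xs X) ∣X∣)
  hasSize⇔ (suc n) X {xs} {Xs} = mk⇔
    (λ (S , Z , ∣S∣ , ∣Z∣ , S⊎Z) → trans (∣∣-disjointUnion S Z (lookup Xs X) S⊎Z)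
      (cong₂ _+_ (to (isSingleton⇔ 1F {xs} {Z ∷ S ∷ Xs}) ∣S∣) (to (hasSize⇔ n 0F) ∣Z∣)))
    (λ ∣X∣ → let S , Z , ∣S∣ , ∣Z∣ , S⊎Z , _ = splitAt (lookup Xs X) 1 ∣X∣ in
      S , Z , from (isSingleton⇔ 1F {xs} {Z ∷ S ∷ Xs}) ∣S∣ , from (hasSize⇔ n 0F) ∣Z∣ , S⊎Z)

  isBlock : Fin k → Fin k → Fin m → Fin k → Fml m k
  isBlock W Y y B = all₁
    (and (imp (mem 0F B) (and (mem 0F W) (and (le (suc y) 0F) below-next)))
         (imp (mem 0F W) (imp (le (suc y) 0F) (imp below-next (mem 0F B)))))
    where
    below-next : Fml _ _
    -- Variable 0 is an arbitrary later start and variable 1 the element in question. Speaking of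
    -- all later starts instead of the next one makes the condition vacuous for the last block.
    below-next = all₁ (imp (mem 0F Y) (imp (lt (suc (suc y)) 0F) (lt 1F 0F)))

  isBlock⇔ : ∀ (W Y : Fin k) (y : Fin m) B {xs Xs} → Sat 𝓜 (isBlock W Y y B) xs Xs ⇔
    IsBlock (lookup Xs W) (lookup Xs Y) (lookup xs y) (lookup Xs B)
  isBlock⇔ W Y y B {xs} {Xs} = mk⇔ fwd bwd
    where
    fwd : Sat 𝓜 (isBlock W Y y B) xs Xs → IsBlock (lookup Xs W) (lookup Xs Y) (lookup xs y) (lookup Xs B)
    fwd h u =
      (λ u∈B → let u∈W , y≤u , u<Y = proj₁ (h u) u∈B in
        u∈W , to ≤⇔ y≤u , λ v v∈Y y<v → to <⇔ (u<Y v v∈Y (from <⇔ y<v))) ,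
      λ u∈W y≤u u<Y → proj₂ (h u) u∈W (from ≤⇔ y≤u)
        λ v v∈Y y<v → from <⇔ (u<Y v v∈Y (to <⇔ y<v))
    bwd : IsBlock (lookup Xs W) (lookup Xs Y) (lookup xs y) (lookup Xs B) → Sat 𝓜 (isBlock W Y y B) xs Xs
    bwd h u =
      (λ u∈B → let u∈W , y≤u , u<Y = proj₁ (h u) u∈B in
        u∈W , from ≤⇔ y≤u , λ v v∈Y y<v → from <⇔ (u<Y v v∈Y (to <⇔ y<v))) ,
      λ u∈W y≤u u<Y → proj₂ (h u) u∈W (to ≤⇔ y≤u)
        λ v v∈Y y<v → to <⇔ (u<Y v v∈Y (from <⇔ y<v))

  -- The block size enters only through `θ`: it is a fixed number for periodicity and the value of a
  -- variable for multiplication.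
  isBlocking : Fin k → Fin k → Fml (suc m) (suc k) → Fml m k
  isBlocking W Y θ =
    and (all₁ (imp (mem 0F W) (ex₁ (and (mem 0F Y) (le 0F 1F)))))
        (all₁ (imp (mem 0F Y) (ex₂ (and (isBlock (suc W) (suc Y) 0F 0F) θ))))

  isBlocking⇔ : ∀ (W Y : Fin k) (θ : Fml (suc m) (suc k)) {xs Xs c} →
    (∀ y B → Sat 𝓜 θ (y ∷ xs) (B ∷ Xs) ⇔ ∣ B ∣ ≡ c) →
    Sat 𝓜 (isBlocking W Y θ) xs Xs ⇔ IsBlocking c (lookup Xs W) (lookup Xs Y)
  isBlocking⇔ W Y θ {xs} {Xs} θ⇔ = mk⇔
    (λ (cover , blocks) →
      (λ x x∈W → let y , y∈Y , y≤x = cover x x∈W in y , y∈Y , to ≤⇔ y≤x) ,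
      λ y y∈Y → let B , isB , ∣B∣ = blocks y y∈Y in
        B , to (isBlock⇔ (suc W) (suc Y) 0F 0F {y ∷ xs} {B ∷ Xs}) isB , to (θ⇔ y B) ∣B∣)
    (λ (cover , blocks) →
      (λ x x∈W → let y , y∈Y , y≤x = cover x x∈W in y , y∈Y , from ≤⇔ y≤x) ,
      λ y y∈Y → let B , isB , ∣B∣ = blocks y y∈Y in
        B , from (isBlock⇔ (suc W) (suc Y) 0F 0F {y ∷ xs} {B ∷ Xs}) isB , from (θ⇔ y B) ∣B∣)

  -- For `c = 0` this says that the size is exactly `r`, so one formula covers both isolated sizes
  -- and arithmetic progressions.
  hasSizeMod : ℕ → ℕ → Fin k → Fml m k
  hasSizeMod r c X = ex₂ (ex₂ (ex₂ (and (hasSize r 2F)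
    (and (isBlocking 1F 0F (hasSize c 0F)) (disjointUnion 2F 1F (suc (suc (suc X))))))))

  hasSizeMod⇔ : ∀ r c (X : Fin k) {xs : Vec ℕ m} {Xs} →
    Sat 𝓜 (hasSizeMod r c X) xs Xs ⇔ (∃ λ q → ∣ lookup Xs X ∣ ≡ r + c * q)
  hasSizeMod⇔ r c X {xs} {Xs} = mk⇔
    (λ (Z , W , Y , ∣Z∣ , W-blocks , Z⊎W) → ∣ Y ∣ , trans (∣∣-disjointUnion Z W (lookup Xs X) Z⊎W)
      (cong₂ _+_ (to (hasSize⇔ r 2F {xs} {Y ∷ W ∷ Z ∷ Xs}) ∣Z∣)
                 (∣∣-blocking W (increasing Y) (to (blocks⇔ Z W Y) W-blocks))))
    (λ (q , ∣X∣) →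
      let Z , W , ∣Z∣ , ∣W∣ , Z⊎W , _ = splitAt (lookup Xs X) r ∣X∣
          Y , W-blocks , _ = blocking c q W ∣W∣
      in Z , W , Y , from (hasSize⇔ r 2F {xs} {Y ∷ W ∷ Z ∷ Xs}) ∣Z∣ ,
         from (blocks⇔ Z W Y) W-blocks , Z⊎W)
    where
    blocks⇔ : ∀ Z W Y → Sat 𝓜 (isBlocking 1F 0F (hasSize c 0F)) xs (Y ∷ W ∷ Z ∷ Xs) ⇔ IsBlocking c W Y
    blocks⇔ Z W Y = isBlocking⇔ 1F 0F (hasSize c 0F) λ y B → hasSize⇔ c 0F

-- Ultimately periodic sets of sizes

module _ (R : Pred 𝓕 0ℓ) (R-card : IsCardinalityRelation R) where

  Size∈R : Pred ℕ 0ℓ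
  Size∈R n = R (interval 0 n)

  R⇔ : ∀ X {n} → ∣ X ∣ ≡ n → R X ⇔ Size∈R n
  R⇔ X {n} ∣X∣ = R-card X (interval 0 n) (trans ∣X∣ (sym (∣interval∣ 0 n)))

  module _ (n p : ℕ) (periodic : ∀ z → n ≤ z → Size∈R z ⇔ Size∈R (z + suc p)) where

    private
      open OrderFormulas ⟨ℕ,<⟩ (⇔-id _)

      -- Below the threshold `n` a size stands only for itself, hence the step 0; from `n` on it
      -- stands for all later sizes in its residue class.
      step : ℕ → ℕ
      step j with j <? n
      ... | yes _ = 0
      ... | no  _ = suc p

      shift-by : ∀ j q → n ≤ j → Size∈R j ⇔ Size∈R (j + suc p * q)
      shift-by j zero    n≤j = subst (λ i → Size∈R j ⇔ Size∈R i)
        (sym (trans (cong (j +_) (*-zeroʳ p)) (+-identityʳ j))) (⇔-id _)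
      shift-by j (suc q) n≤j = subst (λ i → Size∈R j ⇔ Size∈R i)
        (trans (+-assoc j (suc p) _) (cong (j +_) (sym (*-suc (suc p) q))))
        (shift-by (j + suc p) q (≤-trans n≤j (m≤m+n j _)) ⇔-∘ periodic j n≤j)

      shift : ∀ j q → Size∈R j ⇔ Size∈R (j + step j * q)
      shift j q with j <? n
      ... | yes _   = subst (λ i → Size∈R j ⇔ Size∈R i) (sym (+-identityʳ j)) (⇔-id _)
      ... | no  j≮n = shift-by j q (≮⇒≥ j≮n)

      -- A size from `n` on is reduced to `n` plus a remainder modulo the period, so finitely many
      -- representatives suffice.
      representative : ∀ s → ∃ λ j → j < n + suc p × ∃ λ q → s ≡ j + step j * q
      representative s with s <? n
      ... | yes s<n = s , <-≤-trans s<n (m≤m+n n _) , 0 ,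
        sym (trans (cong (s +_) (*-zeroʳ (step s))) (+-identityʳ s))
      ... | no  s≮n = j , +-monoʳ-< n (m%n<n (s ∸ n) (suc p)) , q , lemma
        where
        j q : ℕ
        j = n + (s ∸ n) % suc p
        q = (s ∸ n) / suc p
        lemma : s ≡ j + step j * q
        lemma with j <? n
        ... | yes j<n = contradiction j<n (m+n≮m n _)
        ... | no  _   = begin
          s                               ≡⟨ m+[n∸m]≡n (≮⇒≥ s≮n) ⟨
          n + (s ∸ n)                     ≡⟨ cong (n +_) (m≡m%n+[m/n]*n (s ∸ n) (suc p)) ⟩
          n + ((s ∸ n) % suc p + q * suc p) ≡⟨ +-assoc n _ _ ⟨
          j + q * suc p                   ≡⟨ cong (j +_) (*-comm q (suc p)) ⟩
          j + suc p * q                   ∎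
          where open ≡-Reasoning

      Reached : ℕ → 𝓕 → Set
      Reached N X = ∃ λ j → j < N × Size∈R j × ∃ λ q → ∣ X ∣ ≡ j + step j * q

      -- Each `j` below `N` in `Size∈R` contributes one disjunct. Whether it does is settled by
      -- excluded middle under the double negation, one `j` at a time.
      Reached-definable : ∀ N →
        ¬ ¬ Σ (Fml 0 1) λ φ → ∀ X → Sat ⟨ℕ,<⟩ φ [] (X ∷ []) ⇔ Reached N X
      -- The empty disjunction is an unsatisfiable formula.
      Reached-definable zero ¬φ =
        ¬φ (ex₁ (lt 0F 0F) , λ X → mk⇔ (λ (x , x<x) → contradiction x<x (<-irrefl refl)) λ ())
      Reached-definable (suc N) ¬φ = Reached-definable N λ (φ , φ⇔) →
        ¬¬-excluded-middle λ
        { (yes N∈R) → ¬φ (or (hasSizeMod N (step N) 0F) φ , λ X → mk⇔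
            [ (λ h → N , n<1+n N , N∈R , to (hasSizeMod⇔ N (step N) 0F) h) ,
              (λ h → let j , j<N , r = to (φ⇔ X) h in j , m<n⇒m<1+n j<N , r) ]′
            λ { (j , j<1+N , j∈R , q) → last-or-earlier φ φ⇔ X j (m≤n⇒m<n∨m≡n (s≤s⁻¹ j<1+N)) j∈R q })
        ; (no N∉R) → ¬φ (φ , λ X → mk⇔
            (λ h → let j , j<N , r = to (φ⇔ X) h in j , m<n⇒m<1+n j<N , r)
            λ { (j , j<1+N , j∈R , q) →
              from (φ⇔ X) (j , ≤∧≢⇒< (s≤s⁻¹ j<1+N) (λ { refl → N∉R j∈R }) , j∈R , q) }) }
        where
        last-or-earlier : ∀ φ → (∀ X → Sat ⟨ℕ,<⟩ φ [] (X ∷ []) ⇔ Reached N X) →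
          ∀ X j → j < N ⊎ j ≡ N → Size∈R j →
          (∃ λ q → ∣ X ∣ ≡ j + step j * q) → Sat ⟨ℕ,<⟩ (or (hasSizeMod N (step N) 0F) φ) [] (X ∷ [])
        last-or-earlier φ φ⇔ X j (inj₁ j<N)  j∈R q = inj₂ (from (φ⇔ X) (j , j<N , j∈R , q))
        last-or-earlier φ φ⇔ X _ (inj₂ refl) _   q = inj₁ (from (hasSizeMod⇔ N (step N) 0F) q)

    periodic⇒¬¬definable : ¬ ¬ Definable ⟨ℕ,<⟩ (unary R)
    -- All representatives lie below `n + suc p`, so at this bound `Reached` coincides with `R`.
    periodic⇒¬¬definable ¬def = Reached-definable (n + suc p) λ (φ , φ⇔) → ¬def (φ , λ {
      [] (X ∷ []) → mk⇔
        (λ h → let j , _ , j∈R , q , ∣X∣ = to (φ⇔ X) h in from (R⇔ X ∣X∣) (to (shift j q) j∈R))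
        (λ X∈R → let j , j<N , q , ∣X∣ = representative ∣ X ∣ in
          from (φ⇔ X) (j , j<N , from (shift j q) (to (R⇔ X ∣X∣) X∈R) , q , ∣X∣)) })

  -- Equicardinality, addition and multiplication from `R`

  module _ (R-undefinable : ¬ Definable ⟨ℕ,<⟩ (unary R)) where

    open OrderFormulas ⟨ℕ,<, R ⟩ (⇔-id _)

    -- The two implications take the place of an equivalence so that satisfaction of `equicardinal`
    -- unfolds to exactly this.
    EquallyExtended : 𝓕 → 𝓕 → Set
    EquallyExtended X Y = ∀ Z U V → IsDisjointUnion X Z U → IsDisjointUnion Y Z V → (R U → R V) × (R V → R U)

    -- Suppose `Y` has `suc p` more elements than `X`. For each `z ≥ ∣ X ∣`, extending both by
    -- `z ∸ ∣ X ∣` elements gives sets of sizes `z` and `z + suc p`, which `R` cannot tell apart. So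
    -- `R` would be ultimately periodic.
    equallyExtended-≮ : ∀ X Y → EquallyExtended X Y → ¬ ∣ X ∣ < ∣ Y ∣
    equallyExtended-≮ X Y X~Y ∣X∣<∣Y∣ with m<n⇒∃[o]m+o≡n ∣X∣<∣Y∣
      where
      m<n⇒∃[o]m+o≡n : ∀ {m n} → m < n → ∃ λ o → n ≡ m + suc o
      m<n⇒∃[o]m+o≡n {m} m<n = _ , sym (trans (+-suc m _) (m+[n∸m]≡n m<n))
    ... | p , ∣Y∣ = periodic⇒¬¬definable ∣ X ∣ p periodic R-undefinable
      where
      xys : List ℕ
      xys = elements X ++ elements Y
      N : ℕ
      N = suc (max 0 xys)
      <N : ∀ {u} → u ∈ˡ xys → u < N
      <N u∈ = s≤s (All.lookup (xs≤max 0 xys) u∈)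
      periodic : ∀ z → ∣ X ∣ ≤ z → Size∈R z ⇔ Size∈R (z + suc p)
      periodic z ∣X∣≤z =
        let Z = interval N (z ∸ ∣ X ∣)
            U , X⊎Z = disjointUnion-interval X N (z ∸ ∣ X ∣) (<N ∘ ∈-++⁺ˡ)
            V , Y⊎Z = disjointUnion-interval Y N (z ∸ ∣ X ∣) (<N ∘ ∈-++⁺ʳ _)
            R⇒ , R⇐ = X~Y Z U V X⊎Z Y⊎Z
        in R⇔ V (∣V∣ V Y⊎Z) ⇔-∘ (mk⇔ R⇒ R⇐ ⇔-∘ ⇔-sym (R⇔ U (∣U∣ U X⊎Z)))
        where
        open ≡-Reasoning
        ∣U∣ : ∀ U → IsDisjointUnion X (interval N (z ∸ ∣ X ∣)) U → ∣ U ∣ ≡ z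
        ∣U∣ U X⊎Z = begin
          ∣ U ∣                                   ≡⟨ ∣∣-disjointUnion X (interval N _) U X⊎Z ⟩
          ∣ X ∣ + ∣ interval N (z ∸ ∣ X ∣) ∣      ≡⟨ cong (∣ X ∣ +_) (∣interval∣ N _) ⟩
          ∣ X ∣ + (z ∸ ∣ X ∣)                     ≡⟨ m+[n∸m]≡n ∣X∣≤z ⟩
          z                                       ∎
        ∣V∣ : ∀ V → IsDisjointUnion Y (interval N (z ∸ ∣ X ∣)) V → ∣ V ∣ ≡ z + suc p
        ∣V∣ V Y⊎Z = begin
          ∣ V ∣                                   ≡⟨ ∣∣-disjointUnion Y (interval N _) V Y⊎Z ⟩
          ∣ Y ∣ + ∣ interval N (z ∸ ∣ X ∣) ∣      ≡⟨ cong₂ _+_ ∣Y∣ (∣interval∣ N _) ⟩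
          ∣ X ∣ + suc p + (z ∸ ∣ X ∣)             ≡⟨ +-assoc ∣ X ∣ (suc p) _ ⟩
          ∣ X ∣ + (suc p + (z ∸ ∣ X ∣))           ≡⟨ cong (∣ X ∣ +_) (+-comm (suc p) _) ⟩
          ∣ X ∣ + ((z ∸ ∣ X ∣) + suc p)           ≡⟨ +-assoc ∣ X ∣ _ _ ⟨
          ∣ X ∣ + (z ∸ ∣ X ∣) + suc p             ≡⟨ cong (_+ suc p) (m+[n∸m]≡n ∣X∣≤z) ⟩
          z + suc p                               ∎

    -- The condition is symmetric, so both strict inequalities are excluded in the same way.
    -- Conversely, equal sizes stay equal when `Z` is added.
    equallyExtended⇔ : ∀ X Y → EquallyExtended X Y ⇔ ∣ X ∣ ≡ ∣ Y ∣
    equallyExtended⇔ X Y = mk⇔ fwd λ ∣X∣≡∣Y∣ Z U V X⊎Z Y⊎Z →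
      let U⇔V = R-card U V (trans (∣∣-disjointUnion X Z U X⊎Z)
                  (trans (cong (_+ ∣ Z ∣) ∣X∣≡∣Y∣) (sym (∣∣-disjointUnion Y Z V Y⊎Z))))
      in to U⇔V , from U⇔V
      where
      fwd : EquallyExtended X Y → ∣ X ∣ ≡ ∣ Y ∣
      fwd X~Y with <-cmp ∣ X ∣ ∣ Y ∣
      ... | tri< ∣X∣<∣Y∣ _ _ = contradiction ∣X∣<∣Y∣ (equallyExtended-≮ X Y X~Y)
      ... | tri≈ _ ∣X∣≡∣Y∣ _ = ∣X∣≡∣Y∣
      ... | tri> _ _ ∣Y∣<∣X∣ = contradiction ∣Y∣<∣X∣ (equallyExtended-≮ Y X
        λ Z U V Y⊎Z X⊎Z → let R⇒ , R⇐ = X~Y Z V U X⊎Z Y⊎Z in R⇐ , R⇒)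

    equicardinal : Fin k → Fin k → Fml m k
    equicardinal X Y = all₂ (all₂ (all₂
      (imp (disjointUnion (suc (suc (suc X))) 2F 1F)
      (imp (disjointUnion (suc (suc (suc Y))) 2F 0F)
      (and (imp (rel 1F [] (1F ∷ [])) (rel 1F [] (0F ∷ [])))
           (imp (rel 1F [] (0F ∷ [])) (rel 1F [] (1F ∷ []))))))))

    -- A number is turned into a set through the initial segment below it, which has that many
    -- elements.
    isSizeOf : Fin m → Fin k → Fml m k
    isSizeOf x X = ex₂ (and
      (all₁ (and (imp (mem 0F 0F) (lt 0F (suc x))) (imp (lt 0F (suc x)) (mem 0F 0F))))
      (equicardinal 0F (suc X)))

    isSizeOf⇔ : ∀ (x : Fin m) (X : Fin k) {xs Xs} →
      Sat ⟨ℕ,<, R ⟩ (isSizeOf x X) xs Xs ⇔ ∣ lookup Xs X ∣ ≡ lookup xs x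
    isSizeOf⇔ x X {xs} {Xs} = mk⇔
      (λ (I , I≐x , I~X) → trans (sym (to (equallyExtended⇔ I (lookup Xs X)) I~X))
        (trans (∣∣-cong I (interval 0 size) λ u → mk⇔
            (λ u∈I → from (∈-interval 0 size) (z≤n , proj₁ (I≐x u) u∈I))
            (λ u∈ → proj₂ (I≐x u) (proj₂ (to (∈-interval 0 size) u∈))))
          (∣interval∣ 0 size)))
      (λ ∣X∣ → interval 0 size ,
        (λ u → (λ u∈ → proj₂ (to (∈-interval 0 size) u∈)) , λ u<size → from (∈-interval 0 size) (z≤n , u<size)) ,
        from (equallyExtended⇔ (interval 0 size) (lookup Xs X)) (trans (∣interval∣ 0 size) (sym ∣X∣)))
      where
      size : ℕ
      size = lookup xs x

    sum : Fin m → Fin m → Fin m → Fml m k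
    sum x y z = ex₂ (ex₂ (ex₂ (and (isSizeOf x 2F) (and (isSizeOf y 1F) (and (isSizeOf z 0F)
      (disjointUnion 2F 1F 0F))))))

    sum⇔ : ∀ (x y z : Fin m) {xs} {Xs : Vec 𝓕 k} →
      Sat ⟨ℕ,<, R ⟩ (sum x y z) xs Xs ⇔ lookup xs x + lookup xs y ≡ lookup xs z
    sum⇔ x y z {xs} {Xs} = mk⇔
      (λ (X , Y , Z , ∣X∣ , ∣Y∣ , ∣Z∣ , X⊎Y) → let Ys = Z ∷ Y ∷ X ∷ Xs in
        trans (sym (cong₂ _+_ (to (isSizeOf⇔ x 2F {xs} {Ys}) ∣X∣) (to (isSizeOf⇔ y 1F {xs} {Ys}) ∣Y∣)))
          (trans (sym (∣∣-disjointUnion X Y Z X⊎Y)) (to (isSizeOf⇔ z 0F {xs} {Ys}) ∣Z∣)))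
      (λ x+y≡z →
        let Z = interval 0 (lookup xs z)
            X , Y , ∣X∣ , ∣Y∣ , X⊎Y , _ = splitAt Z (lookup xs x) (trans (∣interval∣ 0 _) (sym x+y≡z))
            Ys = Z ∷ Y ∷ X ∷ Xs
        in X , Y , Z , from (isSizeOf⇔ x 2F {xs} {Ys}) ∣X∣ , from (isSizeOf⇔ y 1F {xs} {Ys}) ∣Y∣ ,
           from (isSizeOf⇔ z 0F {xs} {Ys}) (∣interval∣ 0 _) , X⊎Y)

    -- A set of size `z` is cut into `y` blocks of `x` elements. The index `suc x` accounts for the
    -- quantifier over starts in `isBlocking`.
    product : Fin m → Fin m → Fin m → Fml m k
    product x y z = ex₂ (ex₂ (and (isSizeOf z 1F) (and (isSizeOf y 0F)
      (isBlocking 1F 0F (isSizeOf (suc x) 0F)))))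

    product⇔ : ∀ (x y z : Fin m) {xs} {Xs : Vec 𝓕 k} →
      Sat ⟨ℕ,<, R ⟩ (product x y z) xs Xs ⇔ lookup xs x * lookup xs y ≡ lookup xs z
    product⇔ x y z {xs} {Xs} = mk⇔
      (λ (W , Y , ∣W∣ , ∣Y∣ , W-blocks) → let Ys = Y ∷ W ∷ Xs in
        trans (sym (cong (lookup xs x *_) (to (isSizeOf⇔ y 0F {xs} {Ys}) ∣Y∣)))
          (trans (sym (∣∣-blocking W (increasing Y) (to (blocks⇔ W Y) W-blocks)))
            (to (isSizeOf⇔ z 1F {xs} {Ys}) ∣W∣)))
      (λ x*y≡z →
        let W = interval 0 (lookup xs z)
            Y , W-blocks , ∣Y∣ = blocking (lookup xs x) (lookup xs y) W (trans (∣interval∣ 0 _) (sym x*y≡z))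
            Ys = Y ∷ W ∷ Xs
        in W , Y , from (isSizeOf⇔ z 1F {xs} {Ys}) (∣interval∣ 0 _) , from (isSizeOf⇔ y 0F {xs} {Ys}) ∣Y∣ ,
           from (blocks⇔ W Y) W-blocks)
      where
      blocks⇔ : ∀ W Y → Sat ⟨ℕ,<, R ⟩ (isBlocking 1F 0F (isSizeOf (suc x) 0F)) xs (Y ∷ W ∷ Xs) ⇔
        IsBlocking (lookup xs x) W Y
      blocks⇔ W Y = isBlocking⇔ 1F 0F (isSizeOf (suc x) 0F) {xs} {Y ∷ W ∷ Xs} λ y B →
        isSizeOf⇔ (suc x) 0F {y ∷ xs} {B ∷ Y ∷ W ∷ Xs}

    +-definable : DefinableFunction ⟨ℕ,<, R ⟩ _+_
    +-definable = sum 0F 1F 2F , λ { (x ∷ y ∷ z ∷ []) [] → sum⇔ 0F 1F 2F {x ∷ y ∷ z ∷ []} {[]} }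

    *-definable : DefinableFunction ⟨ℕ,<, R ⟩ _*_
    *-definable = product 0F 1F 2F , λ { (x ∷ y ∷ z ∷ []) [] → product⇔ 0F 1F 2F {x ∷ y ∷ z ∷ []} {[]} }

-- Recursive functions and undecidability

-- With `s = x + y` the code is at most `s * s + s`, hence below `suc s * suc s`, where the codes
-- with larger sums begin.
pair-sum-≮ : ∀ x y x′ y′ → pair x y ≡ pair x′ y′ → ¬ x + y < x′ + y′
pair-sum-≮ x y x′ y′ eq s<s′ = <⇒≢ (begin-strict
  s * s + x              ≤⟨ +-monoʳ-≤ (s * s) (m≤m+n x y) ⟩
  s * s + s              ≡⟨ +-comm (s * s) s ⟩
  suc s * s              <⟨ *-monoʳ-< (suc s) (n<1+n s) ⟩
  suc s * suc s          ≤⟨ *-mono-≤ s<s′ s<s′ ⟩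
  s′ * s′                ≤⟨ m≤m+n _ x′ ⟩
  s′ * s′ + x′           ∎) eq
  where
  open ≤-Reasoning
  s s′ : ℕ
  s = x + y
  s′ = x′ + y′

pair-injective : ∀ x y x′ y′ → pair x y ≡ pair x′ y′ → x ≡ x′ × y ≡ y′
pair-injective x y x′ y′ eq with <-cmp (x + y) (x′ + y′)
... | tri< s<s′ _ _ = contradiction s<s′ (pair-sum-≮ x y x′ y′ eq)
... | tri> _ _ s′<s = contradiction s′<s (pair-sum-≮ x′ y′ x y (sym eq))
... | tri≈ _ s≡s′ _ = x≡x′ , +-cancelˡ-≡ x _ _ (trans s≡s′ (cong (_+ y′) (sym x≡x′)))
  where
  x≡x′ : x ≡ x′
  x≡x′ = +-cancelˡ-≡ ((x + y) * (x + y)) _ _ (trans eq (cong (λ s → s * s + x′) (sym s≡s′)))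

-- Induction on `f`, and on the derivation for primitive recursion. This makes the answers 0 and 1
-- of a decision procedure exclusive.
⇓-functional : ∀ (f : Rec n) {xs y z} → f [ xs ]⇓ y → f [ xs ]⇓ z → y ≡ z
⇓-functional zer zer⇓ zer⇓ = refl
⇓-functional succ succ⇓ succ⇓ = refl
⇓-functional (proj i) (proj⇓ _) (proj⇓ _) = refl
⇓-functional (comp f gs) (comp⇓ ys gs⇓ys f⇓y) (comp⇓ zs gs⇓zs f⇓z) =
  ⇓-functional f f⇓y (subst (λ as → f [ as ]⇓ _)
    (lookup-injective λ i → sym (functionals gs i (gs⇓ys i) (gs⇓zs i))) f⇓z)
  where
  lookup-injective : ∀ {l} {as bs : Vec ℕ l} → (∀ i → lookup as i ≡ lookup bs i) → as ≡ bs
  lookup-injective {as = as} {bs} eq = trans (sym (tabulate∘lookup as)) (trans (tabulate-cong eq) (tabulate∘lookup bs))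
  functionals : ∀ {l} (gs : Vec (Rec _) l) i {xs y z} → lookup gs i [ xs ]⇓ y → lookup gs i [ xs ]⇓ z → y ≡ z
  functionals (g ∷ gs) zero    = ⇓-functional g
  functionals (g ∷ gs) (suc i) = functionals gs i
⇓-functional (prec f g) (prec₀ f⇓y) (prec₀ f⇓z) = ⇓-functional f f⇓y f⇓z
⇓-functional (prec f g) (precₛ r⇓ g⇓y) (precₛ r⇓′ g⇓z)
  with refl ← ⇓-functional (prec f g) r⇓ r⇓′ = ⇓-functional g g⇓y g⇓z
⇓-functional (μ f) {_} {y} {z} (μ⇓ f⇓0 below) (μ⇓ f⇓0′ below′) with <-cmp y z
... | tri< y<z _ _ = contradiction (⇓-functional f f⇓0 (proj₂ (below′ y y<z))) λ ()
... | tri≈ _ y≡z _ = y≡z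
... | tri> _ _ z<y = contradiction (⇓-functional f f⇓0′ (proj₂ (below z z<y))) λ ()

-- The evaluation rules are inverted here and below into the conditions that the clauses of `value`
-- express.
zer-⇔ : ∀ {xs : Vec ℕ n} {y} → zer [ xs ]⇓ y ⇔ y ≡ 0
zer-⇔ = mk⇔ (λ { zer⇓ → refl }) λ { refl → zer⇓ }

succ-⇔ : ∀ {x y} → succ [ x ∷ [] ]⇓ y ⇔ suc x ≡ y
succ-⇔ = mk⇔ (λ { succ⇓ → refl }) λ { refl → succ⇓ }

proj-⇔ : ∀ i {xs : Vec ℕ n} {y} → proj i [ xs ]⇓ y ⇔ lookup xs i ≡ y
proj-⇔ i = mk⇔ (λ { (proj⇓ _) → refl }) λ { refl → proj⇓ i }

comp-⇔ : ∀ {f : Rec l} {gs : Vec (Rec n) l} {xs y} → comp f gs [ xs ]⇓ y ⇔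
  (∃ λ ys → (∀ i → lookup gs i [ xs ]⇓ lookup ys i) × f [ ys ]⇓ y)
comp-⇔ = mk⇔ (λ { (comp⇓ ys gs⇓ys f⇓y) → ys , gs⇓ys , f⇓y }) λ (ys , gs⇓ys , f⇓y) → comp⇓ ys gs⇓ys f⇓y

μ-⇔ : ∀ {f : Rec (suc n)} {xs y} → μ f [ xs ]⇓ y ⇔
  (f [ y ∷ xs ]⇓ 0 × (∀ z → z < y → ∃ λ v → f [ z ∷ xs ]⇓ suc v))
μ-⇔ = mk⇔ (λ { (μ⇓ f⇓0 below) → f⇓0 , below }) λ (f⇓0 , below) → μ⇓ f⇓0 below

-- A finite set of codes of pairs (i , prec f g (i ∷ xs)), closed under
-- predecessors of i, certifies each of the values it contains.
IsTrace : Rec n → Rec (suc (suc n)) → Vec ℕ n → 𝓕 → Set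
IsTrace f g xs X = ∀ i y → pair i y ∈ X →
  (i ≡ 0 × f [ xs ]⇓ y) ⊎
  (∃₂ λ j r → suc j ≡ i × pair j r ∈ X × g [ j ∷ r ∷ xs ]⇓ y)

trace-sound : ∀ {f : Rec n} {g xs} X → IsTrace f g xs X →
  ∀ i y → pair i y ∈ X → prec f g [ i ∷ xs ]⇓ y
trace-sound X tr zero y p∈X with tr zero y p∈X
... | inj₁ (_ , f⇓y) = prec₀ f⇓y
trace-sound X tr (suc i) y p∈X with tr (suc i) y p∈X
... | inj₂ (_ , r , refl , q∈X , g⇓y) = precₛ (trace-sound X tr i r q∈X) g⇓y

-- Induction on the derivation, adding one pair per step; injectivity of `pair` recovers index and
-- value of the added code.
trace-complete : ∀ {f : Rec n} {g xs i y} → prec f g [ i ∷ xs ]⇓ y →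
  ∃ λ X → pair i y ∈ X × IsTrace f g xs X
trace-complete {f = f} {g} {xs} {y = y} (prec₀ f⇓y) = singleton (pair 0 y) , here refl , tr
  where
  tr : IsTrace f g xs (singleton (pair 0 y))
  tr i z (here eq) with refl , refl ← pair-injective i z 0 y eq = inj₁ (refl , f⇓y)
trace-complete {f = f} {g} {xs} {y = y} (precₛ {i = i} {r} r⇓ g⇓y) with trace-complete r⇓
... | X , q∈X , tr = X⁺ , from (∈-fromList us) (here refl) , tr⁺
  where
  us : List ℕ
  us = pair (suc i) y ∷ elements X
  X⁺ : 𝓕
  X⁺ = fromList us
  X⊆X⁺ : ∀ {u} → u ∈ X → u ∈ X⁺
  X⊆X⁺ = from (∈-fromList us) ∘ there
  tr⁺ : IsTrace f g xs X⁺
  tr⁺ j z p∈X⁺ with to (∈-fromList us) p∈X⁺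
  ... | here eq with refl , refl ← pair-injective j z (suc i) y eq =
    inj₂ (i , r , refl , X⊆X⁺ q∈X , g⇓y)
  ... | there p∈X with tr j z p∈X
  ...   | inj₁ h = inj₁ h
  ...   | inj₂ (j′ , r′ , eq , q′∈X , g⇓z) = inj₂ (j′ , r′ , eq , X⊆X⁺ q′∈X , g⇓z)

prec-⇔ : ∀ {f : Rec n} {g xs i y} → prec f g [ i ∷ xs ]⇓ y ⇔
  (∃ λ X → pair i y ∈ X × IsTrace f g xs X)
prec-⇔ {i = i} {y} = mk⇔ trace-complete λ (X , p∈X , tr) → trace-sound X tr i y p∈X

-- Recursive functions that compute codes of formulas

constant : ℕ → Rec n
constant zero    = zer
constant (suc c) = comp succ (constant c ∷ [])

comp₁⇓ : ∀ {f : Rec 1} {g : Rec n} {xs a y} → g [ xs ]⇓ a → f [ a ∷ [] ]⇓ y → comp f (g ∷ []) [ xs ]⇓ y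
comp₁⇓ g⇓a = comp⇓ _ λ { 0F → g⇓a }

comp₂⇓ : ∀ {f : Rec 2} {g h : Rec n} {xs a b y} → g [ xs ]⇓ a → h [ xs ]⇓ b →
  f [ a ∷ b ∷ [] ]⇓ y → comp f (g ∷ h ∷ []) [ xs ]⇓ y
comp₂⇓ g⇓a h⇓b = comp⇓ _ λ { 0F → g⇓a ; 1F → h⇓b }

constant⇓ : ∀ c {xs : Vec ℕ n} → constant c [ xs ]⇓ c
constant⇓ zero    = zer⇓
constant⇓ (suc c) = comp₁⇓ (constant⇓ c) succ⇓

addition multiplication pairing : Rec 2
addition       = prec (proj 0F) (comp succ (proj 1F ∷ []))
multiplication = prec zer (comp addition (proj 2F ∷ proj 1F ∷ []))
pairing        = comp addition (comp multiplication (addition ∷ addition ∷ []) ∷ proj 0F ∷ [])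

addition⇓ : ∀ x y → addition [ x ∷ y ∷ [] ]⇓ (x + y)
addition⇓ zero    y = prec₀ (proj⇓ 0F)
addition⇓ (suc x) y = precₛ (addition⇓ x y) (comp₁⇓ (proj⇓ 1F) succ⇓)

multiplication⇓ : ∀ x y → multiplication [ x ∷ y ∷ [] ]⇓ (x * y)
multiplication⇓ zero    y = prec₀ zer⇓
multiplication⇓ (suc x) y = precₛ (multiplication⇓ x y) (comp₂⇓ (proj⇓ 2F) (proj⇓ 1F) (addition⇓ y (x * y)))

pairing⇓ : ∀ x y → pairing [ x ∷ y ∷ [] ]⇓ pair x y
pairing⇓ x y = comp₂⇓ (comp₂⇓ (addition⇓ x y) (addition⇓ x y) (multiplication⇓ (x + y) (x + y)))
  (proj⇓ 0F) (addition⇓ _ x)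

-- The code of ex₁ (and φ ψ), as a function of the codes of φ and ψ.
codeExAnd : ℕ → ℕ → ℕ
codeExAnd a b = pair 7 (pair 3 (pair a b))

exAnd : Rec n → Rec n → Rec n
exAnd g h = comp pairing (constant 7 ∷ comp pairing (constant 3 ∷ comp pairing (g ∷ h ∷ []) ∷ []) ∷ [])

exAnd⇓ : ∀ {g h : Rec n} {xs} a b → g [ xs ]⇓ a → h [ xs ]⇓ b → exAnd g h [ xs ]⇓ codeExAnd a b
exAnd⇓ a b g⇓a h⇓b = comp₂⇓ (constant⇓ 7)
  (comp₂⇓ (constant⇓ 3) (comp₂⇓ g⇓a h⇓b (pairing⇓ a b)) (pairing⇓ 3 (pair a b)))
  (pairing⇓ 7 (pair 3 (pair a b)))

-- With `a` the code of the formula for zero and `b` that of the successor formula, these are the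
-- codes of the numerals.
codeIterate : ℕ → ℕ → ℕ → ℕ
codeIterate a b zero    = a
codeIterate a b (suc n) = codeExAnd (codeIterate a b n) b

iterate : ℕ → ℕ → Rec 1
iterate a b = prec (constant a) (exAnd (proj 1F) (constant b))

iterate⇓ : ∀ a b n → iterate a b [ n ∷ [] ]⇓ codeIterate a b n
iterate⇓ a b zero    = prec₀ (constant⇓ a)
iterate⇓ a b (suc n) = precₛ (iterate⇓ a b n) (exAnd⇓ (codeIterate a b n) b (proj⇓ 1F) (constant⇓ b))

-- The diagonal function: from the code `c` of a formula it computes the code of the sentence that
-- asserts this formula of the number `c`.
codeSelfApplication : ℕ → ℕ → ℕ → ℕ
codeSelfApplication a b c = codeExAnd (codeIterate a b c) c

codeSelfApplication⇓ : ∀ a b → ∃ λ (s : Rec 1) → ∀ c → s [ c ∷ [] ]⇓ codeSelfApplication a b c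
codeSelfApplication⇓ a b = exAnd (iterate a b) (proj 0F) ,
  λ c → exAnd⇓ (codeIterate a b c) c (iterate⇓ a b c) (proj⇓ 0F)

-- Graphs of recursive functions as formulas

module Arithmetic {τ : Signature} (𝓜 : Structure ((2 , 0) ∷ τ))
  (<⇔ : ∀ {x y} → interpret 𝓜 zero (x ∷ y ∷ []) [] ⇔ x < y)
  (sum product : ∀ {m k} → Fin m → Fin m → Fin m → Formula ((2 , 0) ∷ τ) m k)
  (sum⇔ : ∀ {m k} (x y z : Fin m) {xs} {Xs : Vec 𝓕 k} →
    Sat 𝓜 (sum x y z) xs Xs ⇔ lookup xs x + lookup xs y ≡ lookup xs z)
  (product⇔ : ∀ {m k} (x y z : Fin m) {xs} {Xs : Vec 𝓕 k} →
    Sat 𝓜 (product x y z) xs Xs ⇔ lookup xs x * lookup xs y ≡ lookup xs z)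
  where

  open OrderFormulas 𝓜 <⇔

  isZero : Fin m → Fml m k
  isZero x = all₁ (le (suc x) 0F)

  isZero⇔ : ∀ (x : Fin m) {xs} {Xs : Vec 𝓕 k} → Sat 𝓜 (isZero x) xs Xs ⇔ lookup xs x ≡ 0
  isZero⇔ x = mk⇔ (λ h → n≤0⇒n≡0 (to ≤⇔ (h 0))) λ x≡0 u → from ≤⇔ (≤-trans (≤-reflexive x≡0) z≤n)

  isSuc : Fin m → Fin m → Fml m k
  isSuc x y = and (lt x y) (all₁ (imp (lt 0F (suc y)) (le 0F (suc x))))

  isSuc⇔ : ∀ (x y : Fin m) {xs} {Xs : Vec 𝓕 k} →
    Sat 𝓜 (isSuc x y) xs Xs ⇔ suc (lookup xs x) ≡ lookup xs y
  isSuc⇔ x y {xs} {Xs} = mk⇔ fwd bwd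
    where
    fwd : Sat 𝓜 (isSuc x y) xs Xs → suc (lookup xs x) ≡ lookup xs y
    fwd (x<y , least) = ≤-antisym (to <⇔ x<y)
      (≮⇒≥ λ 1+x<y → 1+n≰n (to ≤⇔ (least _ (from <⇔ 1+x<y))))
    bwd : suc (lookup xs x) ≡ lookup xs y → Sat 𝓜 (isSuc x y) xs Xs
    bwd 1+x≡y = from <⇔ (≤-reflexive 1+x≡y) ,
      λ u u<y → from ≤⇔ (s≤s⁻¹ (≤-trans (to <⇔ u<y) (≤-reflexive (sym 1+x≡y))))

  isPair : Fin m → Fin m → Fin m → Fml m k
  isPair x y z = ex₁ (and (sum (suc x) (suc y) 0F)
    (ex₁ (and (product 1F 1F 0F) (sum 0F (suc (suc x)) (suc (suc z))))))

  isPair⇔ : ∀ (x y z : Fin m) {xs} {Xs : Vec 𝓕 k} →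
    Sat 𝓜 (isPair x y z) xs Xs ⇔ pair (lookup xs x) (lookup xs y) ≡ lookup xs z
  isPair⇔ x y z {xs} {Xs} = mk⇔ fwd bwd
    where
    fwd : Sat 𝓜 (isPair x y z) xs Xs → pair (lookup xs x) (lookup xs y) ≡ lookup xs z
    fwd (s , s≡ , q , q≡ , z≡) = trans
      (cong (_+ lookup xs x) (trans (cong (λ t → t * t) (to (sum⇔ (suc x) (suc y) 0F {s ∷ xs}) s≡))
        (to (product⇔ 1F 1F 0F {q ∷ s ∷ xs}) q≡)))
      (to (sum⇔ 0F (suc (suc x)) (suc (suc z)) {q ∷ s ∷ xs}) z≡)
    bwd : pair (lookup xs x) (lookup xs y) ≡ lookup xs z → Sat 𝓜 (isPair x y z) xs Xs
    bwd z≡ = s , from (sum⇔ (suc x) (suc y) 0F {s ∷ xs}) refl ,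
      s * s , from (product⇔ 1F 1F 0F {s * s ∷ s ∷ xs}) refl ,
      from (sum⇔ 0F (suc (suc x)) (suc (suc z)) {s * s ∷ s ∷ xs}) z≡
      where
      s : ℕ
      s = lookup xs x + lookup xs y

  exs : ∀ l → Fml (l + m) k → Fml m k
  exs zero    φ = φ
  exs (suc l) φ = exs l (ex₁ φ)

  exs⇔ : ∀ l (φ : Fml (l + m) k) {xs Xs} →
    Sat 𝓜 (exs l φ) xs Xs ⇔ (∃ λ (ys : Vec ℕ l) → Sat 𝓜 φ (ys Vec.++ xs) Xs)
  exs⇔ zero    φ = mk⇔ (λ h → [] , h) λ { ([] , h) → h }
  exs⇔ (suc l) φ = mk⇔
    (λ h → let ys , y , h′ = to (exs⇔ l (ex₁ φ)) h in y ∷ ys , h′)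
    λ { (y ∷ ys , h) → from (exs⇔ l (ex₁ φ)) (ys , y , h) }

  -- The map `ρ` names the variable that holds each argument and the last index the one that holds
  -- the value, so no substitution into formulas is needed.
  value  : Rec n → (Fin n → Fin m) → Fin m → Fml m k
  values : Vec (Rec n) l → (Fin n → Fin m) → (Fin l → Fin m) → Fml m k

  value zer         ρ y = isZero y
  value succ        ρ y = isSuc (ρ 0F) y
  value (proj i)    ρ y = eq (ρ i) y
  value (comp {l = l} f gs) ρ y =
    exs l (and (values gs ((l ↑ʳ_) ∘ ρ) (_↑ˡ _)) (value f (_↑ˡ _) (l ↑ʳ y)))
  value (prec f g)  ρ y = ex₂ (and
    (ex₁ (and (isPair (suc (ρ 0F)) (suc y) 0F) (mem 0F 0F)))
    -- Variables 2, 1 and 0 are an index, its value and their code. Inside the second disjunct the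
    -- preceding index and value become 1 and 0, which moves the current ones to 4 and 3.
    (all₁ (all₁ (all₁ (imp (isPair 2F 1F 0F) (imp (mem 0F 0F) (or
      (and (isZero 2F) (value f ((3 ↑ʳ_) ∘ ρ ∘ suc) 1F))
      (ex₁ (ex₁ (and (isSuc 1F 4F) (and (ex₁ (and (isPair 2F 1F 0F) (mem 0F 0F)))
        (value g (1F Fun.∷ 0F Fun.∷ ((5 ↑ʳ_) ∘ ρ ∘ suc)) 3F))))))))))))
  value (μ f)       ρ y = and
    (ex₁ (and (isZero 0F) (value f (suc y Fun.∷ (suc ∘ ρ)) 0F)))
    (all₁ (imp (lt 0F (suc y)) (ex₁ (ex₁ (and (isSuc 1F 0F) (value f (2F Fun.∷ ((3 ↑ʳ_) ∘ ρ)) 0F))))))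

  -- The empty conjunction is a valid formula.
  values []       ρ η = all₁ (eq 0F 0F)
  values (g ∷ gs) ρ η = and (value g ρ (η zero)) (values gs ρ (η ∘ suc))

  value⇔ : ∀ (f : Rec n) (ρ : Fin n → Fin m) y {xs} {Xs : Vec 𝓕 k} →
    Sat 𝓜 (value f ρ y) xs Xs ⇔ f [ tabulate (lookup xs ∘ ρ) ]⇓ lookup xs y
  values⇔ : ∀ (gs : Vec (Rec n) l) (ρ : Fin n → Fin m) η {xs} {Xs : Vec 𝓕 k} →
    Sat 𝓜 (values gs ρ η) xs Xs ⇔ (∀ i → lookup gs i [ tabulate (lookup xs ∘ ρ) ]⇓ lookup xs (η i))

  value⇔ zer      ρ y {xs} {Xs} = ⇔-sym zer-⇔ ⇔-∘ isZero⇔ y {xs} {Xs}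
  value⇔ succ     ρ y {xs} {Xs} = ⇔-sym succ-⇔ ⇔-∘ isSuc⇔ (ρ 0F) y {xs} {Xs}
  value⇔ (proj i) ρ y {xs} = mk⇔
    (λ h → from (proj-⇔ i) (trans (lookup∘tabulate _ i) (to ≡⇔ h)))
    (λ h → from ≡⇔ (trans (sym (lookup∘tabulate _ i)) (to (proj-⇔ i) h)))
  value⇔ (comp {l = l} f gs) ρ y {xs} {Xs} = ⇔-sym comp-⇔ ⇔-∘ (mk⇔
    (λ (ys , h₁ , h₂) → ys , to (args ys) h₁ , to (body ys) h₂)
    (λ (ys , h₁ , h₂) → ys , from (args ys) h₁ , from (body ys) h₂)
    ⇔-∘ exs⇔ l _)
    where
    args : ∀ ys → Sat 𝓜 (values gs ((l ↑ʳ_) ∘ ρ) (_↑ˡ _)) (ys Vec.++ xs) Xs ⇔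
      (∀ i → lookup gs i [ tabulate (lookup xs ∘ ρ) ]⇓ lookup ys i)
    args ys = mk⇔
      (λ h i → subst₂ (lookup gs i [_]⇓_) (tabulate-cong (lookup-++ʳ ys xs ∘ ρ)) (lookup-++ˡ ys xs i)
        (to (values⇔ gs ((l ↑ʳ_) ∘ ρ) (_↑ˡ _)) h i))
      (λ h → from (values⇔ gs ((l ↑ʳ_) ∘ ρ) (_↑ˡ _)) λ i →
        subst₂ (lookup gs i [_]⇓_) (sym (tabulate-cong (lookup-++ʳ ys xs ∘ ρ))) (sym (lookup-++ˡ ys xs i)) (h i))
    ys≡ : ∀ ys → tabulate (lookup (ys Vec.++ xs) ∘ (_↑ˡ _)) ≡ ys
    ys≡ ys = trans (tabulate-cong (lookup-++ˡ ys xs)) (tabulate∘lookup ys)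
    body : ∀ ys → Sat 𝓜 (value f (_↑ˡ _) (l ↑ʳ y)) (ys Vec.++ xs) Xs ⇔ f [ ys ]⇓ lookup xs y
    body ys = mk⇔
      (λ h → subst₂ (f [_]⇓_) (ys≡ ys) (lookup-++ʳ ys xs y) (to (value⇔ f (_↑ˡ _) (l ↑ʳ y)) h))
      (λ h → from (value⇔ f (_↑ˡ _) (l ↑ʳ y)) (subst₂ (f [_]⇓_) (sym (ys≡ ys)) (sym (lookup-++ʳ ys xs y)) h))
  value⇔ (prec f g) ρ y {xs} {Xs} = ⇔-sym prec-⇔ ⇔-∘ mk⇔ fwd bwd
    where
    p : ℕ
    p = pair (lookup xs (ρ 0F)) (lookup xs y)
    Trace : Set
    Trace = ∃ λ X → p ∈ X × IsTrace f g (tabulate (lookup xs ∘ ρ ∘ suc)) X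
    fwd : Sat 𝓜 (value (prec f g) ρ y) xs Xs → Trace
    fwd (X , (p , p≡ , p∈X) , h) = X ,
      subst (_∈ X) (sym (to (isPair⇔ (suc (ρ 0F)) (suc y) 0F {p ∷ xs} {X ∷ Xs}) p≡)) p∈X ,
      λ i z p∈X → Sum.map
        (λ (i≡0 , h) → to (isZero⇔ 2F {pair i z ∷ z ∷ i ∷ xs} {X ∷ Xs}) i≡0 ,
                       to (value⇔ f ((3 ↑ʳ_) ∘ ρ ∘ suc) 1F) h)
        (λ (j , r , 1+j≡i , (q , q≡ , q∈X) , h) → j , r ,
          to (isSuc⇔ 1F 4F {r ∷ j ∷ pair i z ∷ z ∷ i ∷ xs} {X ∷ Xs}) 1+j≡i ,
          subst (_∈ X) (sym (to (isPair⇔ 2F 1F 0F {q ∷ r ∷ j ∷ pair i z ∷ z ∷ i ∷ xs} {X ∷ Xs}) q≡)) q∈X ,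
          to (value⇔ g (1F Fun.∷ 0F Fun.∷ ((5 ↑ʳ_) ∘ ρ ∘ suc)) 3F) h)
        (h i z (pair i z) (from (isPair⇔ 2F 1F 0F {pair i z ∷ z ∷ i ∷ xs} {X ∷ Xs}) refl) p∈X)
    bwd : Trace → Sat 𝓜 (value (prec f g) ρ y) xs Xs
    bwd (X , p∈X , tr) = X ,
      (p , from (isPair⇔ (suc (ρ 0F)) (suc y) 0F {p ∷ xs} {X ∷ Xs}) refl , p∈X) ,
      λ i z p p≡ p∈X → Sum.map
        (λ (i≡0 , h) → from (isZero⇔ 2F {p ∷ z ∷ i ∷ xs} {X ∷ Xs}) i≡0 ,
                       from (value⇔ f ((3 ↑ʳ_) ∘ ρ ∘ suc) 1F) h)
        (λ (j , r , 1+j≡i , q∈X , h) → j , r ,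
          from (isSuc⇔ 1F 4F {r ∷ j ∷ p ∷ z ∷ i ∷ xs} {X ∷ Xs}) 1+j≡i ,
          (pair j r , from (isPair⇔ 2F 1F 0F {pair j r ∷ r ∷ j ∷ p ∷ z ∷ i ∷ xs} {X ∷ Xs}) refl , q∈X) ,
          from (value⇔ g (1F Fun.∷ 0F Fun.∷ ((5 ↑ʳ_) ∘ ρ ∘ suc)) 3F) h)
        (tr i z (subst (_∈ X) (sym (to (isPair⇔ 2F 1F 0F {p ∷ z ∷ i ∷ xs} {X ∷ Xs}) p≡)) p∈X))
  value⇔ (μ f) ρ y {xs} {Xs} = ⇔-sym μ-⇔ ⇔-∘ mk⇔ fwd bwd
    where
    as : Vec ℕ _
    as = tabulate (lookup xs ∘ ρ)
    Least : Set
    Least = f [ lookup xs y ∷ as ]⇓ 0 × (∀ z → z < lookup xs y → ∃ λ v → f [ z ∷ as ]⇓ suc v)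
    fwd : Sat 𝓜 (value (μ f) ρ y) xs Xs → Least
    fwd ((o , o≡0 , h) , below) =
      subst (f [ lookup xs y ∷ as ]⇓_) (to (isZero⇔ 0F {o ∷ xs} {Xs}) o≡0) (to (value⇔ f (suc y Fun.∷ (suc ∘ ρ)) 0F) h) ,
      λ z z<y → let v , w , w≡ , h′ = below z (from <⇔ z<y) in
        v , subst (f [ z ∷ as ]⇓_) (sym (to (isSuc⇔ 1F 0F {w ∷ v ∷ z ∷ xs} {Xs}) w≡))
              (to (value⇔ f (2F Fun.∷ ((3 ↑ʳ_) ∘ ρ)) 0F) h′)
    bwd : Least → Sat 𝓜 (value (μ f) ρ y) xs Xs
    bwd (f⇓0 , below) =
      (0 , from (isZero⇔ 0F {0 ∷ xs} {Xs}) refl , from (value⇔ f (suc y Fun.∷ (suc ∘ ρ)) 0F) f⇓0) ,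
      λ z z<y → let v , h′ = below z (to <⇔ z<y) in
        v , suc v , from (isSuc⇔ 1F 0F {suc v ∷ v ∷ z ∷ xs} {Xs}) refl ,
        from (value⇔ f (2F Fun.∷ ((3 ↑ʳ_) ∘ ρ)) 0F) h′

  values⇔ []       ρ η = mk⇔ (λ _ ()) λ _ u → from ≡⇔ refl
  values⇔ (g ∷ gs) ρ η = mk⇔
    (λ { (h , hs) zero → to (value⇔ g ρ (η zero)) h ; (h , hs) (suc i) → to (values⇔ gs ρ (η ∘ suc)) hs i })
    (λ h → from (value⇔ g ρ (η zero)) (h zero) , from (values⇔ gs ρ (η ∘ suc)) (h ∘ suc))

  -- Numerals, self-application and the liar sentence

  numeral : ℕ → Fml (suc m) k
  numeral zero    = isZero 0F
  numeral (suc n) = ex₁ (and (numeral n) (isSuc 0F 1F))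

  numeral⇔ : ∀ n {x} {xs : Vec ℕ m} {Xs : Vec 𝓕 k} → Sat 𝓜 (numeral n) (x ∷ xs) Xs ⇔ n ≡ x
  numeral⇔ zero    {x} {xs} {Xs} = mk⇔ (sym ∘ to (isZero⇔ 0F {x ∷ xs} {Xs})) (from (isZero⇔ 0F {x ∷ xs} {Xs}) ∘ sym)
  numeral⇔ (suc n) {x} {xs} {Xs} = mk⇔
    (λ (y , h , 1+y≡x) → trans (cong suc (to (numeral⇔ n) h)) (to (isSuc⇔ 0F 1F {y ∷ x ∷ xs} {Xs}) 1+y≡x))
    (λ 1+n≡x → n , from (numeral⇔ n) refl , from (isSuc⇔ 0F 1F {n ∷ x ∷ xs} {Xs}) 1+n≡x)

  numeralCode : ℕ → ℕ
  numeralCode = codeIterate ⌜ isZero {1} {0} 0F ⌝ ⌜ isSuc {2} {0} 0F 1F ⌝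

  -- The codes of variables, hence of numerals, do not depend on the context.
  ⌜numeral⌝ : ∀ n → ⌜ numeral {m} {0} n ⌝ ≡ numeralCode n
  ⌜numeral⌝ zero    = refl
  ⌜numeral⌝ (suc n) = cong (λ a → codeExAnd a ⌜ isSuc {2} {0} 0F 1F ⌝) (⌜numeral⌝ n)

  -- The free variable is quantified and pinned to the code by a numeral instead of being
  -- substituted, which keeps the code of the result an easy function of the code of `φ`.
  selfApplication : Fml 1 0 → Fml 0 0
  selfApplication φ = ex₁ (and (numeral ⌜ φ ⌝) φ)

  selfApplication⇔ : ∀ φ → Sat 𝓜 (selfApplication φ) [] [] ⇔ Sat 𝓜 φ (⌜ φ ⌝ ∷ []) []
  selfApplication⇔ φ = mk⇔
    (λ (x , h , φx) → subst (λ x → Sat 𝓜 φ (x ∷ []) []) (sym (to (numeral⇔ ⌜ φ ⌝) h)) φx)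
    (λ φx → ⌜ φ ⌝ , from (numeral⇔ ⌜ φ ⌝) refl , φx)

  selfApplicationCode : ℕ → ℕ
  selfApplicationCode = codeSelfApplication ⌜ isZero {1} {0} 0F ⌝ ⌜ isSuc {2} {0} 0F 1F ⌝

  ⌜selfApplication⌝ : ∀ φ → ⌜ selfApplication φ ⌝ ≡ selfApplicationCode ⌜ φ ⌝
  ⌜selfApplication⌝ φ = cong (λ a → codeExAnd a ⌜ φ ⌝) (⌜numeral⌝ ⌜ φ ⌝)

  -- The liar holds exactly if `f` rejects it. If it held, `f` would both accept and reject it; so
  -- it fails, `f` rejects it, and it holds after all.
  liar-undecided : ∀ (f : Rec 1) φ →
    (∀ c → Sat 𝓜 φ (c ∷ []) [] ⇔ f [ selfApplicationCode c ∷ [] ]⇓ 0) →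
    ¬ (∀ ψ → (WMSO 𝓜 ψ → f [ ⌜ ψ ⌝ ∷ [] ]⇓ 1) × (¬ WMSO 𝓜 ψ → f [ ⌜ ψ ⌝ ∷ [] ]⇓ 0))
  liar-undecided f φ φ⇔ f-decides = ¬liar (from liar⇔ (proj₂ (f-decides liar) ¬liar))
    where
    liar : Fml 0 0
    liar = selfApplication φ
    liar⇔ : WMSO 𝓜 liar ⇔ f [ ⌜ liar ⌝ ∷ [] ]⇓ 0
    liar⇔ = subst (λ a → WMSO 𝓜 liar ⇔ f [ a ∷ [] ]⇓ 0) (sym (⌜selfApplication⌝ φ))
      (φ⇔ ⌜ φ ⌝ ⇔-∘ selfApplication⇔ φ)
    ¬liar : ¬ WMSO 𝓜 liar
    ¬liar h = contradiction (⇓-functional f (to liar⇔ h) (proj₁ (f-decides liar) h)) λ ()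

  module _ (f s : Rec 1) {t : ℕ → ℕ} (s⇓ : ∀ c → s [ c ∷ [] ]⇓ t c) where

    -- The answer 0 is introduced as a quantified variable because `value` refers to results only
    -- through variables.
    rejects : Fml 1 0
    rejects = ex₁ (and (isZero 0F) (value (comp f (s ∷ [])) (λ _ → 1F) 0F))

    rejects⇔ : ∀ c → Sat 𝓜 rejects (c ∷ []) [] ⇔ f [ t c ∷ [] ]⇓ 0
    rejects⇔ c = mk⇔ fwd bwd
      where
      comp⇓0 : comp f (s ∷ []) [ c ∷ [] ]⇓ 0 → f [ t c ∷ [] ]⇓ 0
      comp⇓0 (comp⇓ (a ∷ []) s⇓a f⇓0) =
        subst (λ a → f [ a ∷ [] ]⇓ 0) (⇓-functional s (s⇓a 0F) (s⇓ c)) f⇓0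
      fwd : Sat 𝓜 rejects (c ∷ []) [] → f [ t c ∷ [] ]⇓ 0
      fwd (o , o≡0 , h) = comp⇓0 (subst (comp f (s ∷ []) [ c ∷ [] ]⇓_)
        (to (isZero⇔ 0F {o ∷ c ∷ []} {[]}) o≡0)
        (to (value⇔ (comp f (s ∷ [])) (λ _ → 1F) 0F {o ∷ c ∷ []} {[]}) h))
      bwd : f [ t c ∷ [] ]⇓ 0 → Sat 𝓜 rejects (c ∷ []) []
      bwd f⇓0 = 0 , from (isZero⇔ 0F {0 ∷ c ∷ []} {[]}) refl ,
        from (value⇔ (comp f (s ∷ [])) (λ _ → 1F) 0F {0 ∷ c ∷ []} {[]}) (comp₁⇓ (s⇓ c) f⇓0)

  WMSO-undecided : (∃ λ (s : Rec 1) → ∀ c → s [ c ∷ [] ]⇓ selfApplicationCode c) →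
    Undecidable (WMSO 𝓜)
  WMSO-undecided (s , s⇓) (f , f-decides) =
    liar-undecided f (rejects f s s⇓) (rejects⇔ f s s⇓) f-decides

  WMSO-undecidable : Undecidable (WMSO 𝓜)
  WMSO-undecidable = WMSO-undecided (codeSelfApplication⇓ ⌜ isZero {1} {0} 0F ⌝ ⌜ isSuc {2} {0} 0F 1F ⌝)

proposition3p2 : (R : Pred 𝓕 0ℓ) → IsCardinalityRelation R →
    ¬ Definable ⟨ℕ,<⟩ (unary R) →
    DefinableFunction ⟨ℕ,<, R ⟩ _+_ ×
    DefinableFunction ⟨ℕ,<, R ⟩ _*_ ×
    Undecidable (WMSO ⟨ℕ,<, R ⟩)
proposition3p2 R R-card R-undefinable =
  +-definable R R-card R-undefinable ,
  *-definable R R-card R-undefinable ,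
  Arithmetic.WMSO-undecidable ⟨ℕ,<, R ⟩ (⇔-id _)
    (sum R R-card R-undefinable) (product R R-card R-undefinable)
    (sum⇔ R R-card R-undefinable) (product⇔ R R-card R-undefinable)
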